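{- Let $n\ge 2$ and let $SG_n=\mathrm{Cay}(S_n,\{(1\,2),(1\,3),\dots,(1\,n)\})$ be the star graph. Then $SG_n$ has an induced subgraph on more than half of its vertices with maximum degree equal to $1$. In other words, $\sigma(SG_n)=1$.
   Context: For a group $\Gamma$ and $C\subseteq\Gamma$, $\mathrm{Cay}(\Gamma,C)$ is the simple undirected graph on $\Gamma$ in which $\{x,y\}$ is an edge iff $x^{ -1}y\in C$. For a graph $G=(V,E)$, $\alpha(G)$ is its independence number and the sensitivity $\sigma(G)$ is the minimum of the maximum degree of $G[K]$ over all $K\subseteq V$ with $|K|>\alpha(G)$. The star graph is bipartite and regular, so $\alpha(SG_n)=n!/2$. -}

module Defs where

open import Level using (Level; _⊔_)
open import Data.Nat using (ℕ; zero; suc; _<_; _≤_; _!; _/_)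
open import Data.Fin using (Fin)
import Data.Fin as F
open import Data.Fin.Permutation using (Permutation′; _⟨$⟩ʳ_; _∘ₚ_; flip; transpose)
import Data.Fin.Permutation as P
open import Data.List using (List; length)
open import Data.List.Relation.Unary.All using (All)
open import Data.Product using (Σ; ∃; _×_; _,_)
open import Data.Empty using (⊥)
open import Relation.Nullary using (¬_)
open import Relation.Binary using (Rel; Setoid)
open import Relation.Binary.PropositionalEquality using (_≡_; _≢_; refl; sym; trans)
import Data.List.Membership.Setoid as MemS
import Data.List.Relation.Unary.Unique.Setoid as UniqS

record Graph (a ℓ r : Level) : Set (Level.suc (a ⊔ ℓ ⊔ r)) where
  field
    V   : Setoid a ℓ
    Adj : Rel (Setoid.Carrier V) r

module GraphNotions {a ℓ r : Level} (G : Graph a ℓ r) where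
  open Graph G
  open Setoid V renaming (Carrier to Vtx)
  open MemS V using (_∈_)
  open UniqS V using (Unique)

  VSubset : Set (a ⊔ ℓ)
  VSubset = Σ (List Vtx) Unique

  ∣_∣ : VSubset → ℕ
  ∣ (K , _) ∣ = length K

  Independent : VSubset → Set (a ⊔ ℓ ⊔ r)
  Independent (K , _) = ∀ {x y} → x ∈ K → y ∈ K → ¬ Adj x y

  IsIndependenceNumber : ℕ → Set (a ⊔ ℓ ⊔ r)
  IsIndependenceNumber α =
    (Σ VSubset λ I → Independent I × ∣ I ∣ ≡ α)
    × (∀ (I : VSubset) → Independent I → ∣ I ∣ ≤ α)

  DegGe : VSubset → Vtx → ℕ → Set (a ⊔ ℓ ⊔ r)
  DegGe (K , _) v d = Σ VSubset λ N →
    All (λ u → u ∈ K × Adj v u) (Data.Product.proj₁ N) × ∣ N ∣ ≡ d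

  DegLe : VSubset → Vtx → ℕ → Set (a ⊔ ℓ ⊔ r)
  DegLe (K , _) v d = ∀ (N : VSubset) →
    All (λ u → u ∈ K × Adj v u) (Data.Product.proj₁ N) → ∣ N ∣ ≤ d

  MaxDegLe : VSubset → ℕ → Set (a ⊔ ℓ ⊔ r)
  MaxDegLe K d = ∀ {v} → v ∈ Data.Product.proj₁ K → DegLe K v d

  MaxDegGe : VSubset → ℕ → Set (a ⊔ ℓ ⊔ r)
  MaxDegGe K d = Σ Vtx λ v → v ∈ Data.Product.proj₁ K × DegGe K v d

  IsSensitivity : ℕ → Set (a ⊔ ℓ ⊔ r)
  IsSensitivity s = Σ ℕ λ α → IsIndependenceNumber α ×
    ((Σ VSubset λ K → α < ∣ K ∣ × MaxDegLe K s × MaxDegGe K s)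
     × (∀ (K : VSubset) → α < ∣ K ∣ → MaxDegGe K s))

SymSetoid : ℕ → Setoid Level.zero Level.zero
SymSetoid n = record
  { Carrier = Permutation′ n
  ; _≈_ = P._≈_
  ; isEquivalence = record
      { refl = λ _ → refl
      ; sym = λ p i → sym (p i)
      ; trans = λ p q i → trans (p i) (q i) } }

-- group product x · y = x ∘ y (apply y first), inverse = flip
_·_ : ∀ {n} → Permutation′ n → Permutation′ n → Permutation′ n
x · y = y ∘ₚ x

_⁻¹ : ∀ {n} → Permutation′ n → Permutation′ n
x ⁻¹ = flip x

-- Cayley graph Cay(S_n, C): x ~ y iff x⁻¹ y ∈ C  (C a predicate, closed under ≈)
Cay : (n : ℕ) → (Permutation′ n → Set) → Graph Level.zero Level.zero Level.zero
Cay n C = record { V = SymSetoid n ; Adj = λ x y → C ((x ⁻¹) · y) }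

-- C = {(1 2), (1 3), …, (1 n)}; point 1 is F.zero, points 2..n are the nonzero ones.
StarGens : (n : ℕ) → Permutation′ n → Set
StarGens zero _ = ⊥
StarGens (suc k) c = ∃ λ (i : Fin (suc k)) → i ≢ F.zero × c P.≈ transpose F.zero i

SG : ℕ → Graph Level.zero Level.zero Level.zero
SG n = Cay n (StarGens n)

{-# OPTIONS --safe #-}
module Submission where

-- Number the points 0, …, n−1, so that edges exchange position 0 with another position.
-- Call π shifted if π(i+1) = i for some i.  Exchanging positions 0 and i destroys this
-- property only if π(i) = i−1 was the only such equality, and creates it only if
-- π(0) = i−1; either way i is determined by π.  Hence
--   K = {odd shifted} ∪ {even non-shifted}
-- induces maximum degree at most 1.  The map fixing shifted π and exchanging positions
-- i, i+1 of a non-shifted π, with i minimal such that π(i) ≠ i, is an involution that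
-- changes parity off the shifted set, and its only non-shifted fixed point is id.  It
-- injects the odd permutations together with id into K, so K has more than half of the
-- vertices.  Folding the even permutations onto the odd ones along one perfect matching
-- shows that any independent set has at most as many elements as there are odd permutations.

open import Defs
open import Data.Bool using (Bool; true; false; not; _xor_)
open import Data.Bool.Properties
  using (not-¬; ¬-not; not-involutive; not-distribˡ-xor; xor-assoc; xor-comm)
  renaming (_≟_ to _≟ᵇ_)
open import Data.Empty using (⊥; ⊥-elim)
open import Data.Fin using (Fin; zero; suc; inject₁; fromℕ; toℕ; punchIn; _<_; _<?_)
open import Data.Fin.Induction using (<-weakInduction; <-wellFounded)
open import Data.Fin.Permutation
  using (Permutation′; _⟨$⟩ʳ_; _⟨$⟩ˡ_; _∘ₚ_; _≈_; id; insert; remove; transpose; inverseˡ; inverseʳ;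
         insert-remove; lift₀-transpose)
import Data.Fin.Permutation.Components as PC
open import Data.Fin.Properties
  using (_≟_; any?; all?; <-cmp; <-irrefl; <-asym; toℕ-inject₁; inject₁-injective;
         suc-injective; fromℕ≢inject₁; punchIn-injective; injective⇒≤)
open import Data.Fin.Relation.Unary.Top using (view; ‵fromℕ; ‵inject₁)
open import Data.List using (List; []; _∷_; length; lookup; filter; allFin; cartesianProductWith)
import Data.List.Membership.Setoid as Membership
import Data.List.Membership.Setoid.Properties as Mem
open import Data.List.Membership.Propositional.Properties using (∈-allFin)
open import Data.List.Relation.Unary.All using ([]; _∷_)
open import Data.List.Relation.Unary.All.Properties using (¬Any⇒All¬)
open import Data.List.Relation.Unary.AllPairs using ([]; _∷_)
open import Data.List.Relation.Unary.Any using (here; there; index)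
import Data.List.Relation.Unary.Any as Any
import Data.List.Relation.Unary.Unique.Setoid as Uniq
import Data.List.Relation.Unary.Unique.Setoid.Properties as Uniqₚ
import Data.List.Relation.Unary.Unique.Propositional.Properties as UniqP
open import Data.Nat using (ℕ; zero; suc; _≤_; z≤n; s≤s)
import Data.Nat as ℕ
import Data.Nat.Properties as ℕₚ
open import Data.Product using (∃; _×_; _,_; proj₁; proj₂)
open import Data.Sum using (_⊎_; inj₁; inj₂)
open import Function using (_∘_; Injection)
open import Function.Properties.Inverse using (↔⇒↣)
import Induction.WellFounded as WF
open import Level using (0ℓ)
open import Relation.Binary using (Setoid; tri<; tri≈; tri>)
open import Relation.Binary.PropositionalEquality
  using (_≡_; _≢_; _≗_; refl; sym; trans; cong; cong₂; setoid; module ≡-Reasoning)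
open import Relation.Nullary using (¬_; Dec; yes; no; does; contradiction)
open import Relation.Nullary.Decidable
  using (¬?; _×-dec_; _⊎-dec_; _→-dec_; decidable-stable; dec-true; dec-false)

private
  variable
    m n : ℕ

-- Comparing lengths of duplicate-free lists over a setoid

module _ {a ℓ} (S : Setoid a ℓ) where
  open Setoid S using (Carrier) renaming (_≈_ to _≈ₛ_; sym to symₛ)
  open Membership S using (_∈_)
  open Uniq S using (Unique)

  lookup-injective : ∀ {xs} → Unique xs → ∀ i j → lookup xs i ≈ₛ lookup xs j → i ≡ j
  lookup-injective (x∉ ∷ u) zero zero eq = refl
  lookup-injective {x ∷ xs} u zero (suc j) eq =
    contradiction (Mem.∈-resp-≈ S (symₛ eq) (Mem.∈-lookup S xs j)) (Uniqₚ.Unique[x∷xs]⇒x∉xs S u)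
  lookup-injective {x ∷ xs} u (suc i) zero eq =
    contradiction (Mem.∈-resp-≈ S eq (Mem.∈-lookup S xs i)) (Uniqₚ.Unique[x∷xs]⇒x∉xs S u)
  lookup-injective (x∉ ∷ u) (suc i) (suc j) eq = cong suc (lookup-injective u i j eq)

  -- Sending a position in `xs` to the position in `ys` of its image under `g` injects
  -- `Fin (length xs)` into `Fin (length ys)`. Injectivity is asked on members of `xs` only:
  -- `makeOdd` is two-to-one on the whole group and becomes injective on an independent set.
  injection⇒length≤ : ∀ {xs ys} (g : Carrier → Carrier) → Unique xs →
    (∀ {x} → x ∈ xs → g x ∈ ys) →
    (∀ {x y} → x ∈ xs → y ∈ xs → g x ≈ₛ g y → x ≈ₛ y) →
    length xs ≤ length ys
  injection⇒length≤ {xs} g u into inj = injective⇒≤ {f = f} f-injective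
    where
    mem : ∀ i → g (lookup xs i) ∈ _
    mem i = into (Mem.∈-lookup S xs i)
    f = index ∘ mem
    f-injective : ∀ {i j} → f i ≡ f j → i ≡ j
    f-injective {i} {j} eq = lookup-injective u i j
      (inj (Mem.∈-lookup S xs i) (Mem.∈-lookup S xs j) (Mem.index-injective S (mem i) (mem j) eq))

-- Enumeration of the symmetric group by the image of 0

permutations : ∀ n → List (Permutation′ n)
permutations zero    = id ∷ []
permutations (suc n) = cartesianProductWith (insert zero) (allFin (suc n)) (permutations n)

module _ {n : ℕ} where
  open Membership (SymSetoid n) using (_∈_) public
  open Uniq (SymSetoid n) using (Unique) public

permutations-unique : ∀ n → Unique (permutations n)
permutations-unique zero    = [] ∷ []
permutations-unique (suc n) =
  Uniqₚ.cartesianProductWith⁺ (setoid _) (SymSetoid n) (SymSetoid (suc n)) (insert zero) insert-injective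
    (UniqP.allFin⁺ (suc n)) (permutations-unique n)
  where
  insert-injective : ∀ {i j} {π ρ : Permutation′ n} →
    insert zero i π ≈ insert zero j ρ → i ≡ j × π ≈ ρ
  insert-injective {i} {j} eq with eq zero
  ... | refl = refl , λ k → punchIn-injective i _ _ (eq (suc k))

∈-permutations : ∀ (π : Permutation′ n) → π ∈ permutations n
∈-permutations {zero}  π = here λ ()
∈-permutations {suc n} π = Mem.∈-resp-≈ (SymSetoid (suc n))
  {x = insert zero (π ⟨$⟩ʳ zero) (remove zero π)} {π} (insert-remove zero π)
  (Mem.∈-cartesianProductWith⁺ (setoid _) (SymSetoid n) (SymSetoid (suc n)) insert-cong
    (∈-allFin (π ⟨$⟩ʳ zero)) (∈-permutations (remove zero π)))
  where
  insert-cong : ∀ {i j} {π ρ : Permutation′ n} → i ≡ j → π ≈ ρ → insert zero i π ≈ insert zero j ρ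
  insert-cong refl eq zero        = refl
  insert-cong {i} refl eq (suc k) = cong (punchIn i) (eq k)

-- Identities for transpositions

injective : ∀ (π : Permutation′ n) {i j} → π ⟨$⟩ʳ i ≡ π ⟨$⟩ʳ j → i ≡ j
injective π = Injection.injective (↔⇒↣ π)

transpose-left : ∀ (i j : Fin n) → PC.transpose i j i ≡ j
transpose-left i j rewrite dec-true (i ≟ i) refl = refl

transpose-right : ∀ (i j : Fin n) → PC.transpose i j j ≡ i
transpose-right i j with j ≟ i
... | yes j≡i = j≡i
... | no _ rewrite dec-true (j ≟ j) refl = refl

transpose-other : ∀ {i j k : Fin n} → k ≢ i → k ≢ j → PC.transpose i j k ≡ k
transpose-other {i = i} {j} {k} k≢i k≢j
  rewrite dec-false (k ≟ i) k≢i | dec-false (k ≟ j) k≢j = refl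

transpose-comm : ∀ (i j : Fin n) → PC.transpose i j ≗ PC.transpose j i
transpose-comm i j k with k ≟ i
... | yes refl = sym (transpose-right j k)
... | no k≢i with k ≟ j
...   | yes refl = refl
...   | no _ rewrite dec-false (k ≟ i) k≢i = refl

transpose-involutive : ∀ (i j k : Fin n) → PC.transpose i j (PC.transpose i j k) ≡ k
transpose-involutive i j k =
  trans (cong (PC.transpose i j) (transpose-comm i j k)) (PC.transpose-inverse i j)

-- Used to reach the star transpositions from the adjacent ones by induction when computing
-- parities.
transpose-conjugate : ∀ {a b c : Fin n} → a ≢ b → a ≢ c → b ≢ c → ∀ k →
  PC.transpose b c (PC.transpose a b (PC.transpose b c k)) ≡ PC.transpose a c k
transpose-conjugate {a = a} {b} {c} a≢b a≢c b≢c k with k ≟ b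
... | yes refl = begin
  PC.transpose k c (PC.transpose a k c)  ≡⟨ cong (PC.transpose k c) (transpose-other (a≢c ∘ sym) (b≢c ∘ sym)) ⟩
  PC.transpose k c c                     ≡⟨ transpose-right k c ⟩
  k                                      ≡⟨ transpose-other (a≢b ∘ sym) b≢c ⟨
  PC.transpose a c k                     ∎
  where open ≡-Reasoning
... | no k≢b with k ≟ c
...   | yes refl = begin
  PC.transpose b k (PC.transpose a b b)  ≡⟨ cong (PC.transpose b k) (transpose-right a b) ⟩
  PC.transpose b k a                     ≡⟨ transpose-other a≢b a≢c ⟩
  a                                      ≡⟨ transpose-right a k ⟨
  PC.transpose a k k                     ∎
  where open ≡-Reasoning
...   | no k≢c with k ≟ a
...     | yes refl = transpose-left b c
...     | no k≢a rewrite dec-false (k ≟ b) k≢b | dec-false (k ≟ c) k≢c = transpose-other k≢b k≢c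

-- Parity of permutations by counting inversions

belowParity : Fin m → (Fin n → Fin m) → Bool
belowParity {n = zero}  a f = false
belowParity {n = suc n} a f = does (f zero <? a) xor belowParity a (f ∘ suc)

-- Arbitrary functions are allowed because the recursion drops the first value, and what remains is
-- not a permutation of its index set.
inversionParity : (Fin n → Fin m) → Bool
inversionParity {zero}  f = false
inversionParity {suc n} f = belowParity (f zero) (f ∘ suc) xor inversionParity (f ∘ suc)

belowParity-cong : ∀ (a : Fin m) {f g : Fin n → Fin m} → f ≗ g → belowParity a f ≡ belowParity a g
belowParity-cong {n = zero}  a eq = refl
belowParity-cong {n = suc n} a eq =
  cong₂ _xor_ (cong (λ b → does (b <? a)) (eq zero)) (belowParity-cong a (eq ∘ suc))

inversionParity-cong : ∀ {f g : Fin n → Fin m} → f ≗ g → inversionParity f ≡ inversionParity g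
inversionParity-cong {zero}          eq = refl
inversionParity-cong {suc n} {f = f} eq rewrite sym (eq zero) =
  cong₂ _xor_ (belowParity-cong (f zero) (eq ∘ suc)) (inversionParity-cong (eq ∘ suc))

adjacent : Fin n → Permutation′ (suc n)
adjacent i = transpose (inject₁ i) (suc i)

xor-swap : ∀ a b c → a xor (b xor c) ≡ b xor (a xor c)
xor-swap a b c = trans (sym (xor-assoc a b c)) (trans (cong (_xor c) (xor-comm a b)) (xor-assoc b a c))

-- Only the order in which the values are compared with `a` changes.
belowParity-adjacent : ∀ (a : Fin m) (f : Fin (suc n) → Fin m) i →
  belowParity a (f ∘ (adjacent i ⟨$⟩ʳ_)) ≡ belowParity a f
belowParity-adjacent a f zero =
  xor-swap (does (f (suc zero) <? a)) (does (f zero <? a)) _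
belowParity-adjacent a f (suc i) = cong (does (f zero <? a) xor_)
  (trans (belowParity-cong a (cong f ∘ lift₀-transpose (inject₁ i) (suc i) ∘ suc))
         (belowParity-adjacent a (f ∘ suc) i))

does-<?-flip : ∀ {i j : Fin n} → i ≢ j → does (i <? j) ≡ not (does (j <? i))
does-<?-flip {i = i} {j} i≢j with <-cmp i j
... | tri< i<j _ _ = trans (dec-true (i <? j) i<j) (sym (cong not (dec-false (j <? i) (<-asym i<j))))
... | tri≈ _ i≡j _ = contradiction i≡j i≢j
... | tri> _ _ j<i = trans (dec-false (i <? j) (<-asym j<i)) (sym (cong not (dec-true (j <? i) j<i)))

-- The algebra of exchanging the first two values: `d` tells whether the second lies below the
-- first, `b` and `b′` are the parities of the number of later values below the first and the
-- second, and `p` is the inversion parity of the later values.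
xor-exchange : ∀ d b b′ p → (not d xor b′) xor (b xor p) ≡ not ((d xor b) xor (b′ xor p))
xor-exchange d b b′ p = begin
  (not d xor b′) xor (b xor p)      ≡⟨ cong (_xor (b xor p)) (sym (not-distribˡ-xor d b′)) ⟩
  not (d xor b′) xor (b xor p)      ≡⟨ sym (not-distribˡ-xor (d xor b′) _) ⟩
  not ((d xor b′) xor (b xor p))    ≡⟨ cong not (xor-assoc d b′ _) ⟩
  not (d xor (b′ xor (b xor p)))    ≡⟨ cong (λ q → not (d xor q)) (xor-swap b′ b p) ⟩
  not (d xor (b xor (b′ xor p)))    ≡⟨ cong not (sym (xor-assoc d b _)) ⟩
  not ((d xor b) xor (b′ xor p))    ∎
  where open ≡-Reasoning

-- Only the comparison between the two exchanged values is reversed, and distinctness turns this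
-- reversal into a negation.
inversionParity-adjacent : ∀ (f : Fin (suc n) → Fin m) i → f (inject₁ i) ≢ f (suc i) →
  inversionParity (f ∘ (adjacent i ⟨$⟩ʳ_)) ≡ not (inversionParity f)
inversionParity-adjacent f zero f₀≢f₁
  rewrite does-<?-flip f₀≢f₁ = xor-exchange (does (f (suc zero) <? f zero)) _ _ _
inversionParity-adjacent f (suc i) f≢ = begin
  belowParity (f zero) (f ∘ (adjacent (suc i) ⟨$⟩ʳ_) ∘ suc) xor inversionParity (f ∘ (adjacent (suc i) ⟨$⟩ʳ_) ∘ suc)
    ≡⟨ cong₂ _xor_ (belowParity-cong (f zero) shift) (inversionParity-cong shift) ⟩
  belowParity (f zero) (f ∘ suc ∘ (adjacent i ⟨$⟩ʳ_)) xor inversionParity (f ∘ suc ∘ (adjacent i ⟨$⟩ʳ_))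
    ≡⟨ cong₂ _xor_ (belowParity-adjacent (f zero) (f ∘ suc) i) (inversionParity-adjacent (f ∘ suc) i f≢) ⟩
  belowParity (f zero) (f ∘ suc) xor not (inversionParity (f ∘ suc))
    ≡⟨ xor-comm (belowParity (f zero) (f ∘ suc)) _ ⟩
  not (inversionParity (f ∘ suc)) xor belowParity (f zero) (f ∘ suc)
    ≡⟨ sym (not-distribˡ-xor (inversionParity (f ∘ suc)) _) ⟩
  not (inversionParity (f ∘ suc) xor belowParity (f zero) (f ∘ suc))
    ≡⟨ cong not (xor-comm (inversionParity (f ∘ suc)) _) ⟩
  not (belowParity (f zero) (f ∘ suc) xor inversionParity (f ∘ suc)) ∎
  where
  open ≡-Reasoning
  shift : f ∘ (adjacent (suc i) ⟨$⟩ʳ_) ∘ suc ≗ f ∘ suc ∘ (adjacent i ⟨$⟩ʳ_)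
  shift = cong f ∘ lift₀-transpose (inject₁ i) (suc i) ∘ suc

odd? : Permutation′ n → Bool
odd? π = inversionParity (π ⟨$⟩ʳ_)

odd?-cong : ∀ (π ρ : Permutation′ n) → π ≈ ρ → odd? π ≡ odd? ρ
odd?-cong π ρ = inversionParity-cong

belowParity-zero : ∀ (f : Fin n → Fin (suc m)) → belowParity zero f ≡ false
belowParity-zero {zero}  f = refl
belowParity-zero {suc n} f = belowParity-zero (f ∘ suc)

belowParity-suc : ∀ (a : Fin m) (f : Fin n → Fin m) → belowParity (suc a) (λ i → suc (f i)) ≡ belowParity a f
belowParity-suc {n = zero}  a f = refl
belowParity-suc {n = suc n} a f = cong (does (f zero <? a) xor_) (belowParity-suc a (f ∘ suc))

inversionParity-suc : ∀ (f : Fin n → Fin m) → inversionParity (λ i → suc (f i)) ≡ inversionParity f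
inversionParity-suc {zero}  f = refl
inversionParity-suc {suc n} f = cong₂ _xor_ (belowParity-suc (f zero) (f ∘ suc)) (inversionParity-suc (f ∘ suc))

id-even : ∀ n → odd? (id {n}) ≡ false
id-even zero    = refl
id-even (suc n) = cong₂ _xor_ (belowParity-zero {n} suc) (trans (inversionParity-suc {n} (λ i → i)) (id-even n))

inject₁≢suc : ∀ (i : Fin n) → inject₁ i ≢ suc i
inject₁≢suc (suc i) eq = inject₁≢suc i (suc-injective eq)

odd?-adjacent : ∀ (π : Permutation′ (suc n)) i → odd? (adjacent i ∘ₚ π) ≡ not (odd? π)
odd?-adjacent π i = inversionParity-adjacent (π ⟨$⟩ʳ_) i (inject₁≢suc i ∘ injective π)

star : Fin n → Permutation′ (suc n)
star i = transpose zero (suc i)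

-- Induction on `i`: the base case is itself an adjacent exchange, and `(0 i+2)` is the conjugate of
-- `(0 i+1)` by the adjacent transposition `(i+1 i+2)`, so the step flips the parity three times.
odd?-star : ∀ i (π : Permutation′ (suc n)) → odd? (star i ∘ₚ π) ≡ not (odd? π)
odd?-star {suc n} = <-weakInduction (λ i → ∀ π → odd? (star i ∘ₚ π) ≡ not (odd? π))
  (λ π → odd?-adjacent π zero) step
  where
  step : ∀ (i : Fin n) → (∀ π → odd? (star (inject₁ i) ∘ₚ π) ≡ not (odd? π)) →
         ∀ π → odd? (star (suc i) ∘ₚ π) ≡ not (odd? π)
  step i ih π = begin
    odd? (star (suc i) ∘ₚ π)
      ≡⟨ inversionParity-cong (λ k → cong (π ⟨$⟩ʳ_)
           (sym (transpose-conjugate {a = zero} (λ ()) (λ ()) (inject₁≢suc (suc i)) k))) ⟩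
    odd? (s ∘ₚ star (inject₁ i) ∘ₚ s ∘ₚ π)
      ≡⟨ odd?-adjacent (star (inject₁ i) ∘ₚ s ∘ₚ π) (suc i) ⟩
    not (odd? (star (inject₁ i) ∘ₚ s ∘ₚ π))
      ≡⟨ cong not (ih (s ∘ₚ π)) ⟩
    not (not (odd? (s ∘ₚ π)))
      ≡⟨ not-involutive _ ⟩
    odd? (s ∘ₚ π)
      ≡⟨ odd?-adjacent π (suc i) ⟩
    not (odd? π) ∎
    where
    open ≡-Reasoning
    s = adjacent (suc i)

-- Shifted permutations and the involution `toggle`

Shifted : Permutation′ (suc n) → Set
Shifted π = ∃ λ i → π ⟨$⟩ʳ suc i ≡ inject₁ i

shifted? : ∀ (π : Permutation′ (suc n)) → Dec (Shifted π)
shifted? π = any? λ i → (π ⟨$⟩ʳ suc i) ≟ inject₁ i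

Shifted-resp : ∀ (π ρ : Permutation′ (suc n)) → π ≈ ρ → Shifted π → Shifted ρ
Shifted-resp π ρ eq (i , p) = i , trans (sym (eq (suc i))) p

-- The index runs over `Fin n` through `inject₁`, leaving out the last point: a permutation other
-- than the identity moves some earlier point, and its exchange partner `suc i` then exists.
FirstMoved : Permutation′ (suc n) → Fin n → Set
FirstMoved π i = π ⟨$⟩ʳ inject₁ i ≢ inject₁ i × (∀ j → j < i → π ⟨$⟩ʳ inject₁ j ≡ inject₁ j)

firstMoved? : ∀ (π : Permutation′ (suc n)) → Dec (∃ (FirstMoved π))
firstMoved? π = any? λ i → ¬? (_ ≟ _) ×-dec all? λ j → (j <? i) →-dec (_ ≟ _)

FirstMoved-resp : ∀ (π ρ : Permutation′ (suc n)) {i} → π ≈ ρ → FirstMoved π i → FirstMoved ρ i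
FirstMoved-resp π ρ eq (moved , fixed) =
  moved ∘ trans (eq _) , λ j j<i → trans (sym (eq _)) (fixed j j<i)

FirstMoved-unique : ∀ (π : Permutation′ (suc n)) {i j} → FirstMoved π i → FirstMoved π j → i ≡ j
FirstMoved-unique π {i} {j} (mᵢ , fᵢ) (mⱼ , fⱼ) with <-cmp i j
... | tri< i<j _ _ = contradiction (fⱼ i i<j) mᵢ
... | tri≈ _ i≡j _ = i≡j
... | tri> _ _ j<i = contradiction (fᵢ j j<i) mⱼ

-- Well-founded induction fixes every point but the last, and injectivity leaves the last point no
-- other image.
¬FirstMoved⇒id : ∀ (π : Permutation′ (suc n)) → ¬ ∃ (FirstMoved π) → π ≈ id
¬FirstMoved⇒id {n} π ¬first = cases
  where
  fixed : ∀ i → π ⟨$⟩ʳ inject₁ i ≡ inject₁ i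
  fixed = WF.All.wfRec <-wellFounded 0ℓ _ λ i rec →
    decidable-stable (_ ≟ _) λ moved → ¬first (i , moved , λ j j<i → rec j<i)
  cases : π ≈ id
  cases k with view k
  ... | ‵inject₁ i = fixed i
  ... | ‵fromℕ with π ⟨$⟩ʳ fromℕ n in eq
  ...   | l with view l
  ...     | ‵fromℕ = refl
  ...     | ‵inject₁ j = contradiction (injective π (trans eq (sym (fixed j)))) fromℕ≢inject₁

adjacent-left : ∀ (π : Permutation′ (suc n)) i → (adjacent i ∘ₚ π) ⟨$⟩ʳ inject₁ i ≡ π ⟨$⟩ʳ suc i
adjacent-left π i = cong (π ⟨$⟩ʳ_) (transpose-left (inject₁ i) (suc i))

adjacent-right : ∀ (π : Permutation′ (suc n)) i → (adjacent i ∘ₚ π) ⟨$⟩ʳ suc i ≡ π ⟨$⟩ʳ inject₁ i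
adjacent-right π i = cong (π ⟨$⟩ʳ_) (transpose-right (inject₁ i) (suc i))

inject₁<suc : ∀ {i j : Fin n} → inject₁ j ≡ suc i → i < j
inject₁<suc {i = i} {j} eq = ℕₚ.≤-reflexive (trans (sym (cong toℕ eq)) (toℕ-inject₁ j))

-- Position `i` now holds the old value at `suc i`, which is not `i` because `π` is not shifted;
-- earlier positions are untouched. A second `toggle` therefore undoes the first.
adjacent-FirstMoved : ∀ (π : Permutation′ (suc n)) {i} → ¬ Shifted π → FirstMoved π i →
  FirstMoved (adjacent i ∘ₚ π) i
adjacent-FirstMoved π {i} ¬shifted (moved , fixed) =
  (λ eq → ¬shifted (i , trans (sym (adjacent-left π i)) eq)) ,
  λ j j<i → trans
    (cong (π ⟨$⟩ʳ_) (transpose-other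
      (λ eq → <-irrefl (inject₁-injective eq) j<i)
      (λ eq → <-asym j<i (inject₁<suc eq))))
    (fixed j j<i)

-- A new shift must sit at an exchanged position. At position `i = j+1` it would give both `j` and
-- `i+1` the image `j` under `π`, as `j` lies before the first moved point; at position `i+1` it
-- would make `i` a fixed point of `π`.
adjacent-¬Shifted : ∀ (π : Permutation′ (suc n)) {i} → ¬ Shifted π → FirstMoved π i →
  ¬ Shifted (adjacent i ∘ₚ π)
adjacent-¬Shifted π {i} ¬shifted (moved , fixed) (j , eq) = absurd (suc j ≟ inject₁ i) (j ≟ i)
  where
  absurd : Dec (suc j ≡ inject₁ i) → Dec (j ≡ i) → ⊥
  absurd (yes sj≡i) _ = <-asym j<i (inject₁<suc (injective π (trans (fixed j j<i) (sym π[1+i]≡j))))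
    where
    j<i : j < i
    j<i = inject₁<suc (sym sj≡i)
    π[1+i]≡j : π ⟨$⟩ʳ suc i ≡ inject₁ j
    π[1+i]≡j = trans (sym (adjacent-left π i)) (trans (cong ((adjacent i ∘ₚ π) ⟨$⟩ʳ_) (sym sj≡i)) eq)
  absurd (no _)     (yes refl) = moved (trans (sym (adjacent-right π i)) eq)
  absurd (no sj≢i)  (no j≢i)   =
    ¬shifted (j , trans (sym (cong (π ⟨$⟩ʳ_) (transpose-other sj≢i (j≢i ∘ suc-injective)))) eq)

toggle : Permutation′ (suc n) → Permutation′ (suc n)
toggle π with shifted? π | firstMoved? π
... | yes _ | _           = π
-- Only the identity reaches this clause, by `¬FirstMoved⇒id`.
... | no _  | no _        = π
... | no _  | yes (i , _) = adjacent i ∘ₚ π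

toggle-shifted : ∀ (π : Permutation′ (suc n)) → Shifted π → toggle π ≡ π
toggle-shifted π s with shifted? π | firstMoved? π
... | yes _ | _ = refl
... | no ¬s | _ = contradiction s ¬s

toggle-unmoved : ∀ (π : Permutation′ (suc n)) → ¬ ∃ (FirstMoved π) → toggle π ≡ π
toggle-unmoved π ¬f with shifted? π | firstMoved? π
... | yes _ | _     = refl
... | no _  | no _  = refl
... | no _  | yes f = contradiction f ¬f

toggle-adjacent : ∀ (π : Permutation′ (suc n)) {i} → ¬ Shifted π → FirstMoved π i →
  toggle π ≡ adjacent i ∘ₚ π
toggle-adjacent π ¬s f with shifted? π | firstMoved? π
... | yes s | _            = contradiction s ¬s
... | no _  | no ¬f        = contradiction (_ , f) ¬f
... | no _  | yes (i′ , f′) = cong (λ i → adjacent i ∘ₚ π) (FirstMoved-unique π f′ f)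

-- The searches for `π` and `ρ` run separately; they agree because their predicates respect `≈` and
-- the first moved index is unique.
toggle-cong : ∀ (π ρ : Permutation′ (suc n)) → π ≈ ρ → toggle π ≈ toggle ρ
toggle-cong π ρ eq with shifted? π | firstMoved? π
... | yes s | _ rewrite toggle-shifted ρ (Shifted-resp π ρ eq s) = eq
... | no ¬s | yes (i , f)
  rewrite toggle-adjacent ρ (¬s ∘ Shifted-resp ρ π (sym ∘ eq)) (FirstMoved-resp π ρ eq f) = eq ∘ (adjacent i ⟨$⟩ʳ_)
... | no ¬s | no ¬f
  rewrite toggle-unmoved ρ (λ (i , f) → ¬f (i , FirstMoved-resp ρ π (sym ∘ eq) f)) = eq

toggle-involutive : ∀ (π : Permutation′ (suc n)) → toggle (toggle π) ≈ π
toggle-involutive π with shifted? π | firstMoved? π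
... | yes s | _ rewrite toggle-shifted π s = λ _ → refl
... | no ¬s | no ¬f rewrite toggle-unmoved π ¬f = λ _ → refl
... | no ¬s | yes (i , f)
  rewrite toggle-adjacent (adjacent i ∘ₚ π) (adjacent-¬Shifted π ¬s f) (adjacent-FirstMoved π ¬s f) =
  λ k → cong (π ⟨$⟩ʳ_) (transpose-involutive (inject₁ i) (suc i) k)

toggle-injective : ∀ (π ρ : Permutation′ (suc n)) → toggle π ≈ toggle ρ → π ≈ ρ
toggle-injective π ρ eq k = begin
  π ⟨$⟩ʳ k                    ≡⟨ toggle-involutive π k ⟨
  toggle (toggle π) ⟨$⟩ʳ k    ≡⟨ toggle-cong (toggle π) (toggle ρ) eq k ⟩
  toggle (toggle ρ) ⟨$⟩ʳ k    ≡⟨ toggle-involutive ρ k ⟩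
  ρ ⟨$⟩ʳ k                    ∎
  where open ≡-Reasoning

-- The set `K`, and the images under `toggle` that fall into it

Odd : Permutation′ n → Set
Odd π = odd? π ≡ true

Odd-resp : ∀ (π ρ : Permutation′ n) → π ≈ ρ → Odd π → Odd ρ
Odd-resp π ρ eq = trans (sym (odd?-cong π ρ eq))

Selected : Permutation′ (suc n) → Set
Selected π = (Odd π × Shifted π) ⊎ (odd? π ≡ false × ¬ Shifted π)

selected? : ∀ (π : Permutation′ (suc n)) → Dec (Selected π)
selected? π = (_ ≟ᵇ _ ×-dec shifted? π) ⊎-dec (_ ≟ᵇ _ ×-dec ¬? (shifted? π))

Selected-resp : ∀ (π ρ : Permutation′ (suc n)) → π ≈ ρ → Selected π → Selected ρ
Selected-resp π ρ eq (inj₁ (odd , s)) = inj₁ (Odd-resp π ρ eq odd , Shifted-resp π ρ eq s)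
Selected-resp π ρ eq (inj₂ (even , ¬s)) =
  inj₂ (trans (sym (odd?-cong π ρ eq)) even , ¬s ∘ Shifted-resp ρ π (sym ∘ eq))

id-¬Shifted : ¬ Shifted (id {suc n})
id-¬Shifted (i , eq) = inject₁≢suc i (sym eq)

id-unmoved : ¬ ∃ (FirstMoved (id {suc n}))
id-unmoved (i , moved , _) = moved refl

toggle-id-selected : Selected (toggle (id {suc n}))
toggle-id-selected {n} rewrite toggle-unmoved id (id-unmoved {n}) = inj₂ (id-even (suc n) , id-¬Shifted)

toggle-odd-selected : ∀ (π : Permutation′ (suc n)) → Odd π → Selected (toggle π)
toggle-odd-selected {n} π odd with shifted? π | firstMoved? π
... | yes s | _           = inj₁ (odd , s)
... | no ¬s | yes (i , f) = inj₂ (trans (odd?-adjacent π i) (cong not odd) , adjacent-¬Shifted π ¬s f)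
-- Such a `π` would be the identity, which is even.
... | no ¬s | no ¬f       = contradiction
  (trans (sym odd) (trans (odd?-cong π id (¬FirstMoved⇒id π ¬f)) (id-even (suc n)))) λ ()

-- Effect of a star transposition on shiftedness

star-right : ∀ (π : Permutation′ (suc n)) i → (star i ∘ₚ π) ⟨$⟩ʳ suc i ≡ π ⟨$⟩ʳ zero
star-right π i = cong (π ⟨$⟩ʳ_) (transpose-right zero (suc i))

star-other : ∀ (π : Permutation′ (suc n)) {i k} → k ≢ i → (star i ∘ₚ π) ⟨$⟩ʳ suc k ≡ π ⟨$⟩ʳ suc k
star-other π k≢i = cong (π ⟨$⟩ʳ_) (transpose-other {i = zero} (λ ()) (k≢i ∘ suc-injective))

-- Among the nonzero positions only `suc i` changes its value, so a shift elsewhere would survive.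
star-unshifts : ∀ (π : Permutation′ (suc n)) {i k} → π ⟨$⟩ʳ suc k ≡ inject₁ k →
  ¬ Shifted (star i ∘ₚ π) → k ≡ i
star-unshifts π eq ¬s = decidable-stable (_ ≟ _) λ k≢i → ¬s (_ , trans (star-other π k≢i) eq)

-- A shift that appears must be at `suc i`, and this position now holds the old value at 0.
star-shifts : ∀ (π : Permutation′ (suc n)) {i k} → ¬ Shifted π →
  (star i ∘ₚ π) ⟨$⟩ʳ suc k ≡ inject₁ k → π ⟨$⟩ʳ zero ≡ inject₁ i
star-shifts π {i} {k} ¬s eq = begin
  π ⟨$⟩ʳ zero                  ≡⟨ star-right π i ⟨
  (star i ∘ₚ π) ⟨$⟩ʳ suc i     ≡⟨ cong (λ j → (star i ∘ₚ π) ⟨$⟩ʳ suc j) k≡i ⟨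
  (star i ∘ₚ π) ⟨$⟩ʳ suc k     ≡⟨ eq ⟩
  inject₁ k                    ≡⟨ cong inject₁ k≡i ⟩
  inject₁ i                    ∎
  where
  open ≡-Reasoning
  k≡i : k ≡ i
  k≡i = decidable-stable (_ ≟ _) λ k≢i → ¬s (k , trans (sym (star-other π k≢i)) eq)

-- Parity forces a selected neighbour into the other half of `K`. If `π` is odd, any one of its
-- shifts determines both `i` and `j`; if `π` is even, its value at 0 does.
selected-neighbour-unique : ∀ (π : Permutation′ (suc n)) {i j} → Selected π →
  Selected (star i ∘ₚ π) → Selected (star j ∘ₚ π) → i ≡ j
selected-neighbour-unique π {i} {j} = go
  where
  same-parity : ∀ {i b} → odd? π ≡ b → odd? (star i ∘ₚ π) ≢ b
  same-parity {i} p q = not-¬ (trans q (sym p)) (odd?-star i π)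
  go : Selected π → Selected (star i ∘ₚ π) → Selected (star j ∘ₚ π) → i ≡ j
  go (inj₁ (p , _)) (inj₁ (q , _)) _ = contradiction q (same-parity p)
  go (inj₁ (p , _)) _ (inj₁ (q , _)) = contradiction q (same-parity p)
  go (inj₂ (p , _)) (inj₂ (q , _)) _ = contradiction q (same-parity p)
  go (inj₂ (p , _)) _ (inj₂ (q , _)) = contradiction q (same-parity p)
  go (inj₁ (_ , k , eq)) (inj₂ (_ , ¬sᵢ)) (inj₂ (_ , ¬sⱼ)) =
    trans (sym (star-unshifts π eq ¬sᵢ)) (star-unshifts π eq ¬sⱼ)
  go (inj₂ (_ , ¬s)) (inj₁ (_ , _ , eqᵢ)) (inj₁ (_ , _ , eqⱼ)) =
    inject₁-injective (trans (sym (star-shifts π ¬s eqᵢ)) (star-shifts π ¬s eqⱼ))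

-- Adjacency in the star graph as an exchange of positions

module _ {n : ℕ} where
  private
    N : ℕ
    N = suc (suc n)
    S : Setoid 0ℓ 0ℓ
    S = SymSetoid N

  open Graph (SG N) using (Adj)
  open GraphNotions (SG N)

  -- Cancelling `x` in `x⁻¹ y = (0 i+1)` leaves right multiplication by a generator, written
  -- `star i ∘ₚ x` because `∘ₚ` applies its left argument first.
  Adj⇒star : ∀ x y → Adj x y → ∃ λ i → y ≈ star i ∘ₚ x
  Adj⇒star x y (zero , 0≢0 , _) = contradiction refl 0≢0
  Adj⇒star x y (suc i , _ , eq) = i , λ k → trans (sym (inverseʳ x)) (cong (x ⟨$⟩ʳ_) (eq k))

  star⇒Adj : ∀ x y {i} → y ≈ star i ∘ₚ x → Adj x y
  star⇒Adj x y {i} eq = suc i , (λ ()) , λ k → trans (cong (x ⟨$⟩ˡ_) (eq k)) (inverseˡ x)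

  Adj-resp : ∀ x x′ y y′ → x ≈ x′ → y ≈ y′ → Adj x y → Adj x′ y′
  Adj-resp x x′ y y′ x≈x′ y≈y′ adj with i , eq ← Adj⇒star x y adj =
    star⇒Adj x′ y′ λ k → trans (sym (y≈y′ k)) (trans (eq k) (x≈x′ _))

  adj? : ∀ x y → Dec (Adj x y)
  adj? x y = any? λ i → ¬? (i ≟ zero) ×-dec all? λ k → _ ≟ _

  Adj⇒parity : ∀ x y → Adj x y → odd? y ≡ not (odd? x)
  Adj⇒parity x y adj with i , eq ← Adj⇒star x y adj =
    trans (odd?-cong y (star i ∘ₚ x) eq) (odd?-star i x)

  -- The independence number, and edges inside larger sets

  isOdd? : ∀ (π : Permutation′ N) → Dec (Odd π)
  isOdd? π = _ ≟ᵇ _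

  oddPermutations : VSubset
  oddPermutations = filter isOdd? (permutations N) , Uniqₚ.filter⁺ S isOdd? (permutations-unique N)

  ∈-odd⁺ : ∀ π → Odd π → π ∈ proj₁ oddPermutations
  ∈-odd⁺ π = Mem.∈-filter⁺ S isOdd? (λ {π} {ρ} → Odd-resp π ρ) {π} (∈-permutations π)

  ∈-odd⁻ : ∀ π → π ∈ proj₁ oddPermutations → Odd π
  ∈-odd⁻ π = proj₂ ∘ Mem.∈-filter⁻ S isOdd? (λ {π} {ρ} → Odd-resp π ρ) {π} {xs = permutations N}

  odd-independent : Independent oddPermutations
  odd-independent {x} {y} x∈ y∈ adj =
    not-¬ (trans (∈-odd⁻ y y∈) (sym (∈-odd⁻ x x∈))) (Adj⇒parity x y adj)

  -- The perfect matching used here pairs `π` with `star zero ∘ₚ π`; each pair is folded onto its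
  -- odd end.
  makeOdd : Permutation′ N → Permutation′ N
  makeOdd π with isOdd? π
  ... | yes _ = π
  ... | no _  = star zero ∘ₚ π

  makeOdd-odd : ∀ π → Odd (makeOdd π)
  makeOdd-odd π with isOdd? π
  ... | yes odd = odd
  ... | no ¬odd = trans (odd?-star zero π) (cong not (¬-not ¬odd))

  -- Two vertices with the same odd end are equal or form a matching edge. Non-adjacency is taken in
  -- both directions since either of them may be the odd end.
  makeOdd-injective : ∀ x y → ¬ Adj x y → ¬ Adj y x → makeOdd x ≈ makeOdd y → x ≈ y
  makeOdd-injective x y ¬xy ¬yx eq with isOdd? x | isOdd? y
  ... | yes _ | yes _ = eq
  ... | yes _ | no _  = ⊥-elim (¬yx (star⇒Adj y x eq))
  ... | no _  | yes _ = ⊥-elim (¬xy (star⇒Adj x y (sym ∘ eq)))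
  ... | no _  | no _  = λ k → begin
    x ⟨$⟩ʳ k
      ≡⟨ cong (x ⟨$⟩ʳ_) (transpose-involutive zero (suc zero) k) ⟨
    (star zero ∘ₚ x) ⟨$⟩ʳ (star zero ⟨$⟩ʳ k)
      ≡⟨ eq (star zero ⟨$⟩ʳ k) ⟩
    (star zero ∘ₚ y) ⟨$⟩ʳ (star zero ⟨$⟩ʳ k)
      ≡⟨ cong (y ⟨$⟩ʳ_) (transpose-involutive zero (suc zero) k) ⟩
    y ⟨$⟩ʳ k ∎
    where open ≡-Reasoning

  -- With `odd-independent`, this identifies the independence number as the number of odd
  -- permutations.
  independent⇒≤odd : ∀ I → Independent I → ∣ I ∣ ≤ ∣ oddPermutations ∣
  independent⇒≤odd (I , I!) indep = injection⇒length≤ S makeOdd I!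
    (λ {x} _ → ∈-odd⁺ (makeOdd x) (makeOdd-odd x))
    (λ {x} {y} x∈ y∈ → makeOdd-injective x y (indep {x} {y} x∈ y∈) (indep {y} {x} y∈ x∈))

  -- A set larger than the independence number is not independent. Adjacency is decidable, so a
  -- search through the list produces an actual edge, whose first end has degree at least 1.
  large⇒edge : ∀ K → ∣ oddPermutations ∣ ℕ.< ∣ K ∣ → MaxDegGe K 1
  large⇒edge K@(xs , _) α<K with Any.any? (λ x → Any.any? (adj? x) xs) xs
  ... | yes edge with x , x∈ , edge′ ← Membership.find S edge
                 with y , y∈ , adj ← Membership.find S edge′ =
    x , x∈ , (y ∷ [] , [] ∷ []) , (y∈ , adj) ∷ [] , refl
  -- Membership holds only up to `≈`, so an edge between members is moved to the list entries
  -- representing them.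
  ... | no ¬edge = contradiction α<K (ℕₚ.≤⇒≯ (independent⇒≤odd K λ {x} {y} x∈ y∈ adj →
    ¬edge (Any.map (λ {x′} x≈ → Any.map (λ {y′} y≈ → Adj-resp x x′ y y′ x≈ y≈ adj) y∈) x∈)))

  -- Size and maximum degree of `K`, and the sensitivity

  selection : VSubset
  selection = filter selected? (permutations N) , Uniqₚ.filter⁺ S selected? (permutations-unique N)

  ∈-selection⁺ : ∀ π → Selected π → π ∈ proj₁ selection
  ∈-selection⁺ π = Mem.∈-filter⁺ S selected? (λ {π} {ρ} → Selected-resp π ρ) {π} (∈-permutations π)

  ∈-selection⁻ : ∀ π → π ∈ proj₁ selection → Selected π
  ∈-selection⁻ π = proj₂ ∘ Mem.∈-filter⁻ S selected? (λ {π} {ρ} → Selected-resp π ρ) {π} {xs = permutations N}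

  odd<selection : ∣ oddPermutations ∣ ℕ.< ∣ selection ∣
  -- The strict inequality unfolds to a bound on the length of the odd list with `id` put in front.
  odd<selection = injection⇒length≤ S {xs = id ∷ proj₁ oddPermutations} toggle
    (¬Any⇒All¬ _ id∉odd ∷ proj₂ oddPermutations)
    into
    (λ {x} {y} _ _ → toggle-injective x y)
    where
    id∉odd : ¬ id ∈ proj₁ oddPermutations
    id∉odd id∈ = contradiction (trans (sym (∈-odd⁻ id id∈)) (id-even N)) λ ()
    into : ∀ {x} → x ∈ id ∷ proj₁ oddPermutations → toggle x ∈ proj₁ selection
    into {x} (here x≈id) = ∈-selection⁺ (toggle x)
      (Selected-resp (toggle id) (toggle x) (toggle-cong id x (sym ∘ x≈id)) toggle-id-selected)
    into {x} (there x∈)  = ∈-selection⁺ (toggle x) (toggle-odd-selected x (∈-odd⁻ x x∈))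

  selection-maxDeg≤1 : MaxDegLe selection 1
  selection-maxDeg≤1 v∈ ([] , _) _ = z≤n
  selection-maxDeg≤1 v∈ (_ ∷ [] , _) _ = s≤s z≤n
  -- Two listed neighbours arise from the same star transposition, so they are equal, against the
  -- absence of duplicates.
  selection-maxDeg≤1 {v} v∈ (x ∷ y ∷ _ , (x≉y ∷ _) ∷ _) ((x∈ , vx) ∷ (y∈ , vy) ∷ _)
    with i , x≈ ← Adj⇒star v x vx
       | j , y≈ ← Adj⇒star v y vy
    with refl ← selected-neighbour-unique v (∈-selection⁻ v v∈)
                  (Selected-resp x (star i ∘ₚ v) x≈ (∈-selection⁻ x x∈))
                  (Selected-resp y (star j ∘ₚ v) y≈ (∈-selection⁻ y y∈)) =
    contradiction (λ k → trans (x≈ k) (sym (y≈ k))) x≉y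

  sensitivity-one : IsSensitivity 1
  sensitivity-one = ∣ oddPermutations ∣ ,
    ((oddPermutations , (λ {x} {y} → odd-independent {x} {y}) , refl) , independent⇒≤odd) ,
    -- Being larger than the independence number, `selection` itself contains an edge, so its
    -- maximum degree is exactly 1.
    (selection , odd<selection , (λ {v} → selection-maxDeg≤1 {v}) , large⇒edge selection odd<selection) ,
    large⇒edge

theorem3p3 : ∀ (n : ℕ) → 2 ≤ n → GraphNotions.IsSensitivity (SG n) 1
theorem3p3 (suc zero) (s≤s ())
theorem3p3 (suc (suc n)) _ = sensitivity-one
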